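{- Let $p$ be an odd prime, $q=p^e$, and let $k\ge3$ be even and coprime to $p$ with $(k,p)$ hyperbolic, i.e. $1/k+1/p<1/2$. Let $\xi_\kappa$ be a primitive $2k$-th root of unity in $GF(q)$ or $GF(q^2)$ and $\omega_\kappa=\xi_\kappa+\xi_\kappa^{ -1}$. Consider the regular map of type $(k,p)$ given by the generating triple $(X,Y,Z)$ of matrices determined by $\xi_\kappa$ described in the context, where $G=\langle X,Y,Z\rangle$ is isomorphic to $PSL(2,q)$ or $PGL(2,q)$. Then the map is Möbius regular if and only if $\omega_\kappa^2+4=0$.
   Context: A regular map of type $(k,l)$ (vertex degree $k$, face length $l$) is identified with a group $G$ generated by three involutions $X,Y,Z$ such that $XY$, $YZ$, $ZX$ have orders exactly $2,k,l$ respectively; put $R=YZ$. A regular map is Möbius regular if any two distinct adjacent vertices are joined by exactly two edges and any open set supporting these edges contains a Möbius strip. By a known result (Li and Širáň), this is equivalent to the following group-theoretic condition, which may be taken as the definition: $k$ is even and $XR^{k/2}X=R^{k/2}Y$ in $G$. Matrices are regarded up to nonzero scalar multiples, i.e. as elements of $PGL(2,K)$ with $K$ an algebraic closure of $GF(p)$. For type $(k,p)$ with $k$ coprime to $p$ the generating triple is, with $\alpha^2=-1$ and $\eta=(\xi_\kappa-\xi_\kappa^{ -1})^{ -1}$, $$X=\eta\alpha\begin{pmatrix}-\omega_\kappa&-2\xi_\kappa\\2\xi_\kappa^{ -1}&\omega_\kappa\end{pmatrix},\quad Y=-\alpha\begin{pmatrix}0&\xi_\kappa\\ \xi_\kappa^{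 -1}&0\end{pmatrix},\quad Z=\alpha\begin{pmatrix}0&1\\1&0\end{pmatrix}.$$ -}

module Defs where

open import Level using (Level; _⊔_; suc; 0ℓ)
open import Algebra.Bundles using (RawMonoid; Group; RawRing; CommutativeRing)
open import Algebra.Apartness.Bundles using (HeytingField)
open import Algebra.Definitions.RawMonoid using () renaming (_×_ to mult)
import Algebra.Definitions.RawSemiring as RawSemiringDefs
import Algebra.Apartness.Properties.HeytingCommutativeRing as HeytingProperties
import Algebra.Properties.Ring
import Algebra.Properties.AbelianGroup
import Algebra.Properties.CommutativeMonoid.Sum
import Algebra.Properties.Monoid.Mult
import Algebra.Properties.Semiring.Mult
import Algebra.Properties.Semiring.Mult.TCOptimised
import Algebra.Properties.CommutativeSemiring.Exp
import Algebra.Properties.Semiring.Exp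
import Algebra.Solver.Ring
open import Algebra.Solver.Ring.AlmostCommutativeRing
  using (AlmostCommutativeRing; fromCommutativeRing; _-Raw-AlmostCommutative⟶_)
open import Algebra.Morphism.Structures
  using (module RingMorphisms; module GroupMorphisms)
open import Data.Empty using (⊥-elim)
open import Data.Fin.Base using (Fin)
import Data.Fin.Permutation as Perm
open import Data.Integer.Base as ℤ using (ℤ)
import Data.Integer.Properties as ℤₚ
open import Data.Maybe.Base using (Maybe; just; nothing)
open import Data.Nat.Base as ℕ using (ℕ; zero; z≤n; s≤s; NonZero)
import Data.Nat.Coprimality as Coprimality
open import Data.Nat.Divisibility using (_∣_; ∣-refl)
open import Data.Nat.DivMod using (_/_)
open import Data.Nat.GCD using (module Bézout)
open import Data.Nat.Primality using (Prime; prime⇒nonZero; prime⇒nonTrivial)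
import Data.Nat.Properties as ℕₚ
open import Data.Product.Base using (∃; _×_; _,_; proj₁; proj₂)
import Data.Rational.Base as ℚ
open import Data.Sum.Base using (_⊎_; inj₁; inj₂)
open import Data.Vec.Base using (Vec; []; _∷_; map)
open import Function.Bundles using (Inverse; mk↔ₛ′)
import Relation.Binary.PropositionalEquality as ≡
open ≡ using (_≡_)
open import Relation.Binary.Definitions using (Decidable)
import Relation.Binary.Reasoning.Setoid as SetoidReasoning
open import Relation.Nullary using (¬_; yes; no)
open import Relation.Nullary.Decidable using (decidable-stable)
open import Relation.Unary using (Pred)

private variable
  a b c ℓ s : Level

HasOrder : (M : RawMonoid a b) → RawMonoid.Carrier M → ℕ → Set b
HasOrder M g n =
  0 ℕ.< n × mult M n g ≈ ε × (∀ m → 0 ℕ.< m → m ℕ.< n → ¬ mult M m g ≈ ε)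
  where open RawMonoid M

module _ (G : Group a b) where
  open Group G

  data Generated (S : Pred Carrier s) : Pred Carrier (a ⊔ b ⊔ s) where
    gen    : ∀ {g} → S g → Generated S g
    gen-ε  : Generated S ε
    gen-∙  : ∀ {g h} → Generated S g → Generated S h → Generated S (g ∙ h)
    gen-⁻¹ : ∀ {g} → Generated S g → Generated S (g ⁻¹)
    gen-≈  : ∀ {g h} → g ≈ h → Generated S g → Generated S h

  OneOf : (x y z : Carrier) → Pred Carrier b
  OneOf x y z g = g ≈ x ⊎ g ≈ y ⊎ g ≈ z

  subgroup : (P : Pred Carrier s) → P ε →
             (∀ {g h} → P g → P h → P (g ∙ h)) →
             (∀ {g} → P g → P (g ⁻¹)) → Group (a ⊔ s) b
  subgroup P Pε P∙ P⁻¹ = record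
    { Carrier = ∃ P
    ; _≈_     = λ g h → proj₁ g ≈ proj₁ h
    ; _∙_     = λ g h → proj₁ g ∙ proj₁ h , P∙ (proj₂ g) (proj₂ h)
    ; ε       = ε , Pε
    ; _⁻¹     = λ g → proj₁ g ⁻¹ , P⁻¹ (proj₂ g)
    ; isGroup = record
      { isMonoid = record
        { isSemigroup = record
          { isMagma = record
            { isEquivalence = record { refl = refl ; sym = sym ; trans = trans }
            ; ∙-cong        = ∙-cong
            }
          ; assoc = λ g h k → assoc (proj₁ g) (proj₁ h) (proj₁ k)
          }
        ; identity = (λ g → identityˡ (proj₁ g)) , (λ g → identityʳ (proj₁ g))
        }
      ; inverse = (λ g → inverseˡ (proj₁ g)) , (λ g → inverseʳ (proj₁ g))
      ; ⁻¹-cong = ⁻¹-cong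
      }
    }

  ⟨_⟩ : Pred Carrier s → Group (a ⊔ b ⊔ s) b
  ⟨ S ⟩ = subgroup (Generated S) gen-ε gen-∙ gen-⁻¹

infix 4 _≅_

_≅_ : ∀ {a′ b′} → Group a b → Group a′ b′ → Set (a ⊔ b ⊔ a′ ⊔ b′)
G ≅ H = ∃ (GroupMorphisms.IsGroupIsomorphism (Group.rawGroup G) (Group.rawGroup H))

-- k is the vertex degree and l the face length.
record RegularMap (k l : ℕ) (a b : Level) : Set (suc (a ⊔ b)) where
  field
    group : Group a b
  open Group group
  field
    X Y Z        : Carrier
    X-involution : HasOrder rawMonoid X 2
    Y-involution : HasOrder rawMonoid Y 2
    Z-involution : HasOrder rawMonoid Z 2
    XY-order     : HasOrder rawMonoid (X ∙ Y) 2
    YZ-order     : HasOrder rawMonoid (Y ∙ Z) k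
    ZX-order     : HasOrder rawMonoid (Z ∙ X) l
    generates    : ∀ g → Generated group (OneOf group X Y Z) g

  R : Carrier
  R = Y ∙ Z

-- Li and Širáň's group-theoretic form of: any two adjacent vertices are joined
-- by exactly two edges, and every open set supporting them contains a Möbius
-- strip.
MöbiusRegular : ∀ {k l} → RegularMap k l a b → Set b
MöbiusRegular {k = k} M =
  2 ∣ k × X ∙ (k / 2) ⋆ R ∙ X ≈ (k / 2) ⋆ R ∙ Y
  where
  open RegularMap M
  open Group group
  infixr 8 _⋆_
  -- n ⋆ g is the n-th power of g
  _⋆_ : ℕ → Carrier → Carrier
  _⋆_ = mult rawMonoid

Hyperbolic : (k l : ℕ) .{{_ : NonZero k}} .{{_ : NonZero l}} → Set
Hyperbolic k l = (ℤ.+ 1 ℚ./ k) ℚ.+ (ℤ.+ 1 ℚ./ l) ℚ.< ℚ.½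

module IntegerSolver (R : CommutativeRing c ℓ) where
  open CommutativeRing R
  open Algebra.Properties.Ring ring
    using (-0#≈0#; -‿distribˡ-*; -‿distribʳ-*; -‿involutive)
  open Algebra.Properties.AbelianGroup +-abelianGroup using (⁻¹-∙-comm)
  open Algebra.Properties.Semiring.Mult.TCOptimised semiring
    using (1+×; ×-homo-+; ×1-homo-*) renaming (_×_ to _·_)
  open SetoidReasoning setoid

  ⟦_⟧ᶻ : ℤ → Carrier
  ⟦ ℤ.+ n      ⟧ᶻ = n · 1#
  ⟦ ℤ.-[1+ n ] ⟧ᶻ = - (ℕ.suc n · 1#)

  private
    cancel-1 : ∀ x y → (1# + x) - (1# + y) ≈ x - y
    cancel-1 x y = begin
      (1# + x) - (1# + y)       ≈⟨ +-congˡ (sym (⁻¹-∙-comm 1# y)) ⟩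
      (1# + x) + (- 1# + - y)   ≈⟨ +-congʳ (+-comm 1# x) ⟩
      (x + 1#) + (- 1# + - y)   ≈⟨ +-assoc x 1# _ ⟩
      x + (1# + (- 1# + - y))   ≈⟨ +-congˡ (sym (+-assoc 1# (- 1#) (- y))) ⟩
      x + ((1# - 1#) + - y)     ≈⟨ +-congˡ (+-congʳ (-‿inverseʳ 1#)) ⟩
      x + (0# + - y)            ≈⟨ +-congˡ (+-identityˡ (- y)) ⟩
      x - y                     ∎

    ⊖-homo : ∀ m n → ⟦ m ℤ.⊖ n ⟧ᶻ ≈ m · 1# - n · 1#
    ⊖-homo zero      zero      = sym (-‿inverseʳ 0#)
    ⊖-homo (ℕ.suc m) zero      = sym (trans (+-congˡ -0#≈0#) (+-identityʳ _))
    ⊖-homo zero      (ℕ.suc n) = sym (+-identityˡ _)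
    ⊖-homo (ℕ.suc m) (ℕ.suc n) = begin
      ⟦ ℕ.suc m ℤ.⊖ ℕ.suc n ⟧ᶻ       ≡⟨ ≡.cong ⟦_⟧ᶻ (ℤₚ.[1+m]⊖[1+n]≡m⊖n m n) ⟩
      ⟦ m ℤ.⊖ n ⟧ᶻ                   ≈⟨ ⊖-homo m n ⟩
      m · 1# - n · 1#                ≈⟨ sym (cancel-1 _ _) ⟩
      (1# + m · 1#) - (1# + n · 1#)  ≈⟨ sym (+-cong (1+× m 1#) (-‿cong (1+× n 1#))) ⟩
      ℕ.suc m · 1# - ℕ.suc n · 1#    ∎

    neg-homo : ∀ i → ⟦ ℤ.- i ⟧ᶻ ≈ - ⟦ i ⟧ᶻ
    neg-homo (ℤ.+ zero)      = sym -0#≈0#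
    neg-homo (ℤ.+ (ℕ.suc n)) = refl
    neg-homo ℤ.-[1+ n ]      = sym (-‿involutive _)

    +-homo : ∀ i j → ⟦ i ℤ.+ j ⟧ᶻ ≈ ⟦ i ⟧ᶻ + ⟦ j ⟧ᶻ
    +-homo (ℤ.+ m)    (ℤ.+ n)    = ×-homo-+ 1# m n
    +-homo (ℤ.+ m)    ℤ.-[1+ n ] = ⊖-homo m (ℕ.suc n)
    +-homo ℤ.-[1+ m ] (ℤ.+ n)    = trans (⊖-homo n (ℕ.suc m)) (+-comm _ _)
    +-homo ℤ.-[1+ m ] ℤ.-[1+ n ] = begin
      - (ℕ.suc (ℕ.suc (m ℕ.+ n)) · 1#)
        ≡⟨ ≡.cong (λ t → - (ℕ.suc t · 1#)) (≡.sym (ℕₚ.+-suc m n)) ⟩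
      - ((ℕ.suc m ℕ.+ ℕ.suc n) · 1#)
        ≈⟨ -‿cong (×-homo-+ 1# (ℕ.suc m) (ℕ.suc n)) ⟩
      - (ℕ.suc m · 1# + ℕ.suc n · 1#)
        ≈⟨ sym (⁻¹-∙-comm _ _) ⟩
      - (ℕ.suc m · 1#) - ℕ.suc n · 1#  ∎

    *-homo⁺ : ∀ m n → ⟦ ℤ.+ m ℤ.* ℤ.+ n ⟧ᶻ ≈ (m · 1#) * (n · 1#)
    *-homo⁺ m n = begin
      ⟦ ℤ.+ m ℤ.* ℤ.+ n ⟧ᶻ   ≡⟨ ≡.cong ⟦_⟧ᶻ (≡.sym (ℤₚ.pos-* m n)) ⟩
      (m ℕ.* n) · 1#         ≈⟨ ×1-homo-* m n ⟩
      (m · 1#) * (n · 1#)    ∎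

    *-homoʳ : ∀ m j → ⟦ ℤ.+ m ℤ.* j ⟧ᶻ ≈ (m · 1#) * ⟦ j ⟧ᶻ
    *-homoʳ m (ℤ.+ n)    = *-homo⁺ m n
    *-homoʳ m ℤ.-[1+ n ] = begin
      ⟦ ℤ.+ m ℤ.* ℤ.-[1+ n ] ⟧ᶻ
        ≡⟨ ≡.cong ⟦_⟧ᶻ (≡.sym (ℤₚ.neg-distribʳ-* (ℤ.+ m) ℤ.+[1+ n ])) ⟩
      ⟦ ℤ.- (ℤ.+ m ℤ.* ℤ.+[1+ n ]) ⟧ᶻ   ≈⟨ neg-homo (ℤ.+ m ℤ.* ℤ.+[1+ n ]) ⟩
      - ⟦ ℤ.+ m ℤ.* ℤ.+[1+ n ] ⟧ᶻ       ≈⟨ -‿cong (*-homo⁺ m (ℕ.suc n)) ⟩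
      - ((m · 1#) * (ℕ.suc n · 1#))     ≈⟨ -‿distribʳ-* _ _ ⟩
      (m · 1#) * - (ℕ.suc n · 1#)       ∎

    *-homo : ∀ i j → ⟦ i ℤ.* j ⟧ᶻ ≈ ⟦ i ⟧ᶻ * ⟦ j ⟧ᶻ
    *-homo (ℤ.+ m)    j = *-homoʳ m j
    *-homo ℤ.-[1+ m ] j = begin
      ⟦ ℤ.-[1+ m ] ℤ.* j ⟧ᶻ
        ≡⟨ ≡.cong ⟦_⟧ᶻ (≡.sym (ℤₚ.neg-distribˡ-* ℤ.+[1+ m ] j)) ⟩
      ⟦ ℤ.- (ℤ.+[1+ m ] ℤ.* j) ⟧ᶻ   ≈⟨ neg-homo (ℤ.+[1+ m ] ℤ.* j) ⟩
      - ⟦ ℤ.+[1+ m ] ℤ.* j ⟧ᶻ       ≈⟨ -‿cong (*-homoʳ (ℕ.suc m) j) ⟩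
      - ((ℕ.suc m · 1#) * ⟦ j ⟧ᶻ)   ≈⟨ -‿distribˡ-* _ _ ⟩
      - (ℕ.suc m · 1#) * ⟦ j ⟧ᶻ     ∎

    ℤ-rawRing : RawRing 0ℓ 0ℓ
    ℤ-rawRing = record
      { _≈_ = _≡_ ; _+_ = ℤ._+_ ; _*_ = ℤ._*_ ; -_ = ℤ.-_ ; 0# = ℤ.0ℤ ; 1# = ℤ.1ℤ }

    morphism : ℤ-rawRing -Raw-AlmostCommutative⟶ fromCommutativeRing R
    morphism = record
      { ⟦_⟧    = ⟦_⟧ᶻ
      ; +-homo = +-homo
      ; *-homo = *-homo
      ; -‿homo = neg-homo
      ; 0-homo = refl
      ; 1-homo = refl
      }

    _coeff≟_ : ∀ i j → Maybe (⟦ i ⟧ᶻ ≈ ⟦ j ⟧ᶻ)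
    i coeff≟ j with i ℤₚ.≟ j
    ... | yes i≡j = just (reflexive (≡.cong ⟦_⟧ᶻ i≡j))
    ... | no  _   = nothing

  open Algebra.Solver.Ring ℤ-rawRing (fromCommutativeRing R) morphism _coeff≟_ public
    using (Polynomial; con; solve; _:=_; _:+_; _:*_; _:-_; :-_)

-- With a decidable apartness, x # y is equivalent to ¬ (x ≈ y), and
-- x # 0# to x being invertible.

record Field (c ℓ : Level) : Set (suc (c ⊔ ℓ)) where
  field
    heytingField : HeytingField c ℓ ℓ
  open HeytingField heytingField using (_#_; tight; #-irrefl; #-sym; #⇒invertible;
    invertible⇒#; heytingCommutativeRing; isCommutativeRing) public
  field
    _#?_ : Decidable _#_

  commutativeRing : CommutativeRing c ℓ
  commutativeRing = record { isCommutativeRing = isCommutativeRing }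

  open CommutativeRing commutativeRing hiding (isCommutativeRing) public
  open RawRing rawRing using (rawSemiring) public
  open RawSemiringDefs rawSemiring using (_^_) renaming (_×_ to _·_) public

  -- The inverse, extended by 0# to all of the field.
  infix 9 _⁻¹
  _⁻¹ : Carrier → Carrier
  x ⁻¹ with x #? 0#
  ... | yes x#0 = proj₁ (#⇒invertible x#0)
  ... | no  _   = 0#

  IsPrimitiveRoot : ℕ → Carrier → Set ℓ
  IsPrimitiveRoot n x = HasOrder *-rawMonoid x n

module FieldProperties (K : Field c ℓ) where
  open Field K
  open HeytingProperties heytingCommutativeRing public
    using (1#0; x-0≈x; x#0y#0→xy#0; #-congʳ; #-congˡ; invertibleˡ⇒#)

  ⁻¹-inverse : ∀ {x} → x # 0# → x * x ⁻¹ ≈ 1#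
  ⁻¹-inverse {x} x#0 with x #? 0#
  ... | yes p = trans (*-congʳ (sym (x-0≈x x))) (proj₂ (proj₂ (#⇒invertible p)))
  ... | no ¬p = ⊥-elim (¬p x#0)

  #⇒≉ : ∀ {x y} → x # y → ¬ x ≈ y
  #⇒≉ x#y x≈y = #-irrefl x≈y x#y

  ≉⇒# : ∀ {x y} → ¬ x ≈ y → x # y
  ≉⇒# {x} {y} x≉y = decidable-stable (x #? y) (λ ¬x#y → x≉y (proj₁ (tight x y) ¬x#y))

  unit⇒#0 : ∀ {x} y → y * x ≈ 1# → x # 0#
  unit⇒#0 {x} y yx≈1 = invertibleˡ⇒# (y , trans (*-congˡ (x-0≈x x)) yx≈1)

  ⁻¹#0 : ∀ {x} → x # 0# → x ⁻¹ # 0#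
  ⁻¹#0 {x} x#0 = unit⇒#0 x (⁻¹-inverse x#0)

  *-cancel-0 : ∀ {x y} → x # 0# → x * y ≈ 0# → y ≈ 0#
  *-cancel-0 {x} {y} x#0 xy≈0 = proj₁ (tight y 0#) (λ y#0 → #⇒≉ (x#0y#0→xy#0 x#0 y#0) xy≈0)

record M₂ (A : Set a) : Set a where
  constructor mat
  field m₁₁ m₁₂ m₂₁ m₂₂ : A

module Projective (K : Field c ℓ) where
  open Field K
  open FieldProperties K
  open IntegerSolver commutativeRing
  open SetoidReasoning setoid

  infix  4 _≈ₘ_ _~_
  infixl 7 _*ₘ_
  infixr 8 _•_

  _≈ₘ_ : M₂ Carrier → M₂ Carrier → Set ℓ
  mat a b c d ≈ₘ mat a′ b′ c′ d′ = a ≈ a′ × b ≈ b′ × c ≈ c′ × d ≈ d′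

  _*ₘ_ : M₂ Carrier → M₂ Carrier → M₂ Carrier
  mat a b c d *ₘ mat a′ b′ c′ d′ =
    mat (a * a′ + b * c′) (a * b′ + b * d′)
        (c * a′ + d * c′) (c * b′ + d * d′)

  _•_ : Carrier → M₂ Carrier → M₂ Carrier
  x • mat a b c d = mat (x * a) (x * b) (x * c) (x * d)

  I : M₂ Carrier
  I = mat 1# 0# 0# 1#

  det : M₂ Carrier → Carrier
  det (mat a b c d) = a * d - b * c

  adj : M₂ Carrier → M₂ Carrier
  adj (mat a b c d) = mat d (- b) (- c) a

  GL₂ : Set (c ⊔ ℓ)
  GL₂ = ∃ λ A → det A # 0#

  _~_ : M₂ Carrier → M₂ Carrier → Set (c ⊔ ℓ)
  A ~ B = ∃ λ x → x # 0# × A ≈ₘ x • B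

  det-I : det I ≈ 1#
  det-I = solve 0 (con ℤ.1ℤ :* con ℤ.1ℤ :- con ℤ.0ℤ :* con ℤ.0ℤ := con ℤ.1ℤ) refl

  det-* : ∀ A B → det (A *ₘ B) ≈ det A * det B
  det-* (mat a b c d) (mat e f g h) = solve 8 (λ a b c d e f g h →
    (a :* e :+ b :* g) :* (c :* f :+ d :* h) :- (a :* f :+ b :* h) :* (c :* e :+ d :* g)
    := (a :* d :- b :* c) :* (e :* h :- f :* g)) refl a b c d e f g h

  det-• : ∀ x A → det (x • A) ≈ x * x * det A
  det-• x (mat a b c d) = solve 5 (λ x a b c d →
    (x :* a) :* (x :* d) :- (x :* b) :* (x :* c)
    := x :* x :* (a :* d :- b :* c)) refl x a b c d

  det-adj : ∀ A → det (adj A) ≈ det A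
  det-adj (mat a b c d) = solve 4 (λ a b c d →
    d :* a :- (:- b) :* (:- c) := a :* d :- b :* c) refl a b c d

  ≈ₘ-refl : ∀ {A} → A ≈ₘ A
  ≈ₘ-refl = refl , refl , refl , refl

  ≈ₘ-sym : ∀ {A B} → A ≈ₘ B → B ≈ₘ A
  ≈ₘ-sym (p , q , r , s) = sym p , sym q , sym r , sym s

  ≈ₘ-trans : ∀ {A B C} → A ≈ₘ B → B ≈ₘ C → A ≈ₘ C
  ≈ₘ-trans (p , q , r , s) (p′ , q′ , r′ , s′) =
    trans p p′ , trans q q′ , trans r r′ , trans s s′

  •-cong : ∀ {x y A B} → x ≈ y → A ≈ₘ B → x • A ≈ₘ y • B
  •-cong e (p , q , r , s) = *-cong e p , *-cong e q , *-cong e r , *-cong e s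

  •-assoc : ∀ x y A → (x * y) • A ≈ₘ x • (y • A)
  •-assoc x y (mat a b c d) =
    *-assoc x y a , *-assoc x y b , *-assoc x y c , *-assoc x y d

  1•-identity : ∀ A → 1# • A ≈ₘ A
  1•-identity (mat a b c d) =
    *-identityˡ a , *-identityˡ b , *-identityˡ c , *-identityˡ d

  *ₘ-cong : ∀ {A A′ B B′} → A ≈ₘ A′ → B ≈ₘ B′ → A *ₘ B ≈ₘ A′ *ₘ B′
  *ₘ-cong (p , q , r , s) (p′ , q′ , r′ , s′) =
    +-cong (*-cong p p′) (*-cong q r′) , +-cong (*-cong p q′) (*-cong q s′) ,
    +-cong (*-cong r p′) (*-cong s r′) , +-cong (*-cong r q′) (*-cong s s′)

  adj-cong : ∀ {A B} → A ≈ₘ B → adj A ≈ₘ adj B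
  adj-cong (p , q , r , s) = s , -‿cong q , -‿cong r , p

  *ₘ-• : ∀ x y A B → (x • A) *ₘ (y • B) ≈ₘ (x * y) • (A *ₘ B)
  *ₘ-• x y (mat a b c d) (mat a′ b′ c′ d′) =
    e a a′ b c′ , e a b′ b d′ , e c a′ d c′ , e c b′ d d′
    where
    e : ∀ p q r s → x * p * (y * q) + x * r * (y * s) ≈ x * y * (p * q + r * s)
    e = solve 6 (λ x y p q r s →
      x :* p :* (y :* q) :+ x :* r :* (y :* s) := x :* y :* (p :* q :+ r :* s)) refl x y

  adj-• : ∀ x A → adj (x • A) ≈ₘ x • adj A
  adj-• x (mat a b c d) = refl , e b , e c , refl
    where
    e : ∀ p → - (x * p) ≈ x * - p
    e = solve 2 (λ x p → :- (x :* p) := x :* (:- p)) refl x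

  *ₘ-assoc : ∀ A B C → (A *ₘ B) *ₘ C ≈ₘ A *ₘ (B *ₘ C)
  *ₘ-assoc (mat a b c d) (mat a′ b′ c′ d′) (mat a″ b″ c″ d″) =
    e a b a″ c″ , e a b b″ d″ , e c d a″ c″ , e c d b″ d″
    where
    e : ∀ p q r s → (p * a′ + q * c′) * r + (p * b′ + q * d′) * s
                  ≈ p * (a′ * r + b′ * s) + q * (c′ * r + d′ * s)
    e = solve 8 (λ a b c d p q r s →
      (p :* a :+ q :* c) :* r :+ (p :* b :+ q :* d) :* s
      := p :* (a :* r :+ b :* s) :+ q :* (c :* r :+ d :* s)) refl a′ b′ c′ d′

  *ₘ-identityˡ : ∀ A → I *ₘ A ≈ₘ A
  *ₘ-identityˡ (mat a b c d) = e a c , e b d , f a c , f b d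
    where
    e : ∀ p q → 1# * p + 0# * q ≈ p
    e p q = trans (+-cong (*-identityˡ p) (zeroˡ q)) (+-identityʳ p)
    f : ∀ p q → 0# * p + 1# * q ≈ q
    f p q = trans (+-cong (zeroˡ p) (*-identityˡ q)) (+-identityˡ q)

  *ₘ-identityʳ : ∀ A → A *ₘ I ≈ₘ A
  *ₘ-identityʳ (mat a b c d) = e a b , f a b , e c d , f c d
    where
    e : ∀ p q → p * 1# + q * 0# ≈ p
    e p q = trans (+-cong (*-identityʳ p) (zeroʳ q)) (+-identityʳ p)
    f : ∀ p q → p * 0# + q * 1# ≈ q
    f p q = trans (+-cong (zeroʳ p) (*-identityʳ q)) (+-identityˡ q)

  det•I : ∀ A → det A • I ≈ₘ mat (det A) 0# 0# (det A)
  det•I A = *-identityʳ _ , zeroʳ _ , zeroʳ _ , *-identityʳ _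

  adj-inverseˡ : ∀ A → adj A *ₘ A ≈ₘ det A • I
  adj-inverseˡ A@(mat a b c d) = ≈ₘ-trans
    ( solve 4 (λ a b c d → d :* a :+ (:- b) :* c := a :* d :- b :* c) refl a b c d
    , solve 2 (λ b d → d :* b :+ (:- b) :* d := con ℤ.0ℤ) refl b d
    , solve 2 (λ a c → (:- c) :* a :+ a :* c := con ℤ.0ℤ) refl a c
    , solve 4 (λ a b c d → (:- c) :* b :+ a :* d := a :* d :- b :* c) refl a b c d )
    (≈ₘ-sym (det•I A))

  adj-inverseʳ : ∀ A → A *ₘ adj A ≈ₘ det A • I
  adj-inverseʳ A@(mat a b c d) = ≈ₘ-trans
    ( solve 4 (λ a b c d → a :* d :+ b :* (:- c) := a :* d :- b :* c) refl a b c d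
    , solve 2 (λ a b → a :* (:- b) :+ b :* a := con ℤ.0ℤ) refl a b
    , solve 2 (λ c d → c :* d :+ d :* (:- c) := con ℤ.0ℤ) refl c d
    , solve 4 (λ a b c d → c :* (:- b) :+ d :* a := a :* d :- b :* c) refl a b c d )
    (≈ₘ-sym (det•I A))

  ≈ₘ⇒~ : ∀ {A B} → A ≈ₘ B → A ~ B
  ≈ₘ⇒~ {A} {B} A≈B = 1# , 1#0 , ≈ₘ-trans A≈B (≈ₘ-sym (1•-identity B))

  ~-sym : ∀ {A B} → A ~ B → B ~ A
  ~-sym {A} {B} (x , x#0 , A≈xB) = x ⁻¹ , ⁻¹#0 x#0 , ≈ₘ-sym
    (≈ₘ-trans (•-cong refl A≈xB)
    (≈ₘ-trans (≈ₘ-sym (•-assoc (x ⁻¹) x B))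
    (≈ₘ-trans (•-cong (trans (*-comm (x ⁻¹) x) (⁻¹-inverse x#0)) (≈ₘ-refl {B}))
              (1•-identity B))))

  ~-trans : ∀ {A B C} → A ~ B → B ~ C → A ~ C
  ~-trans {C = C} (x , x#0 , A≈xB) (y , y#0 , B≈yC) = x * y , x#0y#0→xy#0 x#0 y#0 ,
    ≈ₘ-trans A≈xB (≈ₘ-trans (•-cong refl B≈yC) (≈ₘ-sym (•-assoc x y C)))

  *ₘ-~-cong : ∀ {A A′ B B′} → A ~ A′ → B ~ B′ → A *ₘ B ~ A′ *ₘ B′
  *ₘ-~-cong {A′ = A′} {B′ = B′} (x , x#0 , p) (y , y#0 , q) =
    x * y , x#0y#0→xy#0 x#0 y#0 , ≈ₘ-trans (*ₘ-cong p q) (*ₘ-• x y A′ B′)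

  adj-~-cong : ∀ {A B} → A ~ B → adj A ~ adj B
  adj-~-cong {B = B} (x , x#0 , p) = x , x#0 , ≈ₘ-trans (adj-cong p) (adj-• x B)

  PGL₂ : Group (c ⊔ ℓ) (c ⊔ ℓ)
  PGL₂ = record
    { Carrier = GL₂
    ; _≈_     = λ A B → proj₁ A ~ proj₁ B
    ; _∙_     = λ A B → proj₁ A *ₘ proj₁ B ,
                #-congʳ (sym (det-* (proj₁ A) (proj₁ B))) (x#0y#0→xy#0 (proj₂ A) (proj₂ B))
    ; ε       = I , #-congʳ (sym det-I) 1#0
    ; _⁻¹     = λ A → adj (proj₁ A) , #-congʳ (sym (det-adj (proj₁ A))) (proj₂ A)
    ; isGroup = record
      { isMonoid = record
        { isSemigroup = record
          { isMagma = record
            { isEquivalence = record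
              { refl = λ {A} → ≈ₘ⇒~ (≈ₘ-refl {proj₁ A}) ; sym = ~-sym ; trans = ~-trans }
            ; ∙-cong        = *ₘ-~-cong
            }
          ; assoc = λ { (A , _) (B , _) (C , _) → ≈ₘ⇒~ (*ₘ-assoc A B C) }
          }
        ; identity = (λ { (A , _) → ≈ₘ⇒~ (*ₘ-identityˡ A) })
                   , (λ { (A , _) → ≈ₘ⇒~ (*ₘ-identityʳ A) })
        }
      ; inverse = (λ { (A , A#0) → det A , A#0 , adj-inverseˡ A })
                , (λ { (A , A#0) → det A , A#0 , adj-inverseʳ A })
      ; ⁻¹-cong = adj-~-cong
      }
    }

  -- The scalar matrices in SL(2) are those identified by _~_, so this is
  -- SL(2) modulo its scalars.
  PSL₂ : Group (c ⊔ ℓ) (c ⊔ ℓ)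
  PSL₂ = subgroup PGL₂ (λ A → det (proj₁ A) ≈ 1#) det-I
    (λ { {A , _} {B , _} p q → trans (det-* A B) (trans (*-cong p q) (*-identityˡ 1#)) })
    (λ { {A , _} p → trans (det-adj A) p })

open Projective using (PGL₂; PSL₂) public

-- The subfield GF(n) of K, as a field with n elements and an embedding into K.
record FiniteSubfield (K : Field c ℓ) (n : ℕ) : Set (suc (c ⊔ ℓ)) where
  field
    subfield : Field c ℓ
  private
    module F = Field subfield
    module K = Field K
  field
    embed             : F.Carrier → K.Carrier
    isRingMonomorphism :
      RingMorphisms.IsRingMonomorphism F.rawRing K.rawRing embed
    cardinality       : Inverse F.setoid (≡.setoid (Fin n))

infix 4 _∈ₛ_

_∈ₛ_ : ∀ {K : Field c ℓ} {n} → Field.Carrier K → FiniteSubfield K n → Set (c ⊔ ℓ)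
_∈ₛ_ {K = K} x F = ∃ λ y → embed y ≈ x
  where
  open FiniteSubfield F
  open Field K

module _ (K : Field c ℓ) where
  open Field K

  -- Value at x of the monic polynomial a₀ + a₁ t + … + aₙ₋₁ tⁿ⁻¹ + tⁿ.
  monic : ∀ {n} → Vec Carrier n → Carrier → Carrier
  monic []       x = 1#
  monic (a ∷ as) x = a + x * monic as x

record AlgebraicClosureGF (p : ℕ) (c ℓ : Level) : Set (suc (c ⊔ ℓ)) where
  field
    K  : Field c ℓ
    GF : FiniteSubfield K p
  open Field K
  open FiniteSubfield GF
  field
    algebraic : ∀ x → ∃ λ n → ∃ λ (as : Vec (Field.Carrier subfield) n) →
                monic K (map embed as) x ≈ 0#
    closed    : ∀ {n} (as : Vec Carrier (ℕ.suc n)) → ∃ λ x → monic K as x ≈ 0#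

module Triple (K : Field c ℓ) (ξ α : Field.Carrier K) where
  open Field K
  open Projective K using (_•_)

  ω η : Carrier
  ω = ξ + ξ ⁻¹
  η = (ξ - ξ ⁻¹) ⁻¹

  X Y Z : M₂ Carrier
  X = (η * α) • mat (- ω)        (- (2 · ξ))
                    (2 · ξ ⁻¹)   ω
  Y = (- α)   • mat 0#           ξ
                    (ξ ⁻¹)       0#
  Z = α       • mat 0#           1#
                    1#           0#

module GroupLemmas (G : Group a b) where
  open Group G
  open Algebra.Properties.Monoid.Mult monoid using (×-congʳ)

  HasOrder-≈ : ∀ {g h n} → g ≈ h → HasOrder rawMonoid h n → HasOrder rawMonoid g n
  HasOrder-≈ {n = n} g≈h (0<n , hⁿ≈ε , least) =
    0<n , trans (×-congʳ n g≈h) hⁿ≈ε ,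
    λ m 0<m m<n gᵐ≈ε → least m 0<m m<n (trans (×-congʳ m (sym g≈h)) gᵐ≈ε)

  module _ (X Y Z : Carrier) where
    private
      S = OneOf G X Y Z
      H = ⟨_⟩ G S
      module H = Group H

    X̂ Ŷ Ẑ : H.Carrier
    X̂ = X , gen (inj₁ refl)
    Ŷ = Y , gen (inj₂ (inj₁ refl))
    Ẑ = Z , gen (inj₂ (inj₂ refl))

    mult-proj₁ : ∀ n g → proj₁ (mult H.rawMonoid n g) ≡ mult rawMonoid n (proj₁ g)
    mult-proj₁ zero      g = ≡.refl
    mult-proj₁ (ℕ.suc n) g = ≡.cong (proj₁ g ∙_) (mult-proj₁ n g)

    HasOrder-⟨⟩ : ∀ {n} g → HasOrder rawMonoid (proj₁ g) n → HasOrder H.rawMonoid g n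
    HasOrder-⟨⟩ {n} g (0<n , gⁿ≈ε , least) =
      0<n , trans (reflexive (mult-proj₁ n g)) gⁿ≈ε ,
      λ m 0<m m<n gᵐ≈ε → least m 0<m m<n (trans (reflexive (≡.sym (mult-proj₁ m g))) gᵐ≈ε)

    generated : ∀ {g} (d : Generated G S g) → Generated H (OneOf H X̂ Ŷ Ẑ) (g , d)
    generated (gen s)     = gen s
    generated gen-ε       = gen-ε
    generated (gen-∙ d e) = gen-∙ (generated d) (generated e)
    generated (gen-⁻¹ d)  = gen-⁻¹ (generated d)
    generated (gen-≈ p d) = gen-≈ p (generated d)

    generatedMap : ∀ {k l} →
      HasOrder rawMonoid X 2 → HasOrder rawMonoid Y 2 → HasOrder rawMonoid Z 2 →
      HasOrder rawMonoid (X ∙ Y) 2 → HasOrder rawMonoid (Y ∙ Z) k →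
      HasOrder rawMonoid (Z ∙ X) l → RegularMap k l _ _
    generatedMap oX oY oZ oXY oYZ oZX = record
      { group        = H
      ; X            = X̂
      ; Y            = Ŷ
      ; Z            = Ẑ
      ; X-involution = HasOrder-⟨⟩ X̂ oX
      ; Y-involution = HasOrder-⟨⟩ Ŷ oY
      ; Z-involution = HasOrder-⟨⟩ Ẑ oZ
      ; XY-order     = HasOrder-⟨⟩ (X̂ H.∙ Ŷ) oXY
      ; YZ-order     = HasOrder-⟨⟩ (Ŷ H.∙ Ẑ) oYZ
      ; ZX-order     = HasOrder-⟨⟩ (Ẑ H.∙ X̂) oZX
      ; generates    = λ g → generated (proj₂ g)
      }

module FiniteFieldLemmas {K : Field c ℓ} {n : ℕ} (F : FiniteSubfield K n) where
  open FiniteSubfield F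
  private
    module F = Field subfield
    module K = Field K
  open RingMorphisms.IsRingMonomorphism isRingMonomorphism
    using (+-homo; 1#-homo; 0#-homo; ⟦⟧-cong)
  open Inverse cardinality using (to; from; strictlyInverseˡ; strictlyInverseʳ; to-cong)
  open F using (_+_; _-_; 1#; 0#)
  open Algebra.Properties.CommutativeMonoid.Sum F.+-commutativeMonoid
    using (sum; sum-permute; sum-cong-≋; ∑-distrib-+; sum-replicate)
  open IntegerSolver F.commutativeRing

  -- Translation by 1# permutes the finitely many elements.
  n·1≈0 : n F.· 1# F.≈ 0#
  n·1≈0 = begin
    n F.· 1#                               ≈⟨ solve 2 (λ s t → t := (s :+ t) :- s) F.refl S _ ⟩
    (S + n F.· 1#) - S                     ≈⟨ F.+-congʳ (F.sym S≈S+n) ⟩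
    S - S                                  ≈⟨ F.-‿inverseʳ S ⟩
    0#                                     ∎
    where
    open SetoidReasoning F.setoid
    S = sum from
    shift : Perm.Permutation n n
    shift = mk↔ₛ′ (λ i → to (from i + 1#)) (λ i → to (from i - 1#))
      (λ i → ≡.trans (to-cong (F.trans (F.+-congʳ (strictlyInverseʳ _))
               (solve 2 (λ x o → (x :- o) :+ o := x) F.refl (from i) 1#))) (strictlyInverseˡ i))
      (λ i → ≡.trans (to-cong (F.trans (F.+-congʳ (strictlyInverseʳ _))
               (solve 2 (λ x o → (x :+ o) :- o := x) F.refl (from i) 1#))) (strictlyInverseˡ i))
    S≈S+n : S F.≈ S + n F.· 1#
    S≈S+n = begin
      S                                  ≈⟨ sum-permute from shift ⟩
      sum (λ i → from (shift Perm.⟨$⟩ʳ i)) ≈⟨ sum-cong-≋ (λ i → strictlyInverseʳ (from i + 1#)) ⟩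
      sum (λ i → from i + 1#)            ≈⟨ ∑-distrib-+ from (λ _ → 1#) ⟩
      S + sum {n} (λ _ → 1#)             ≈⟨ F.+-congˡ (sum-replicate n) ⟩
      S + n F.· 1#                       ∎

  embed-· : ∀ m → embed (m F.· 1#) K.≈ m K.· K.1#
  embed-· zero      = 0#-homo
  embed-· (ℕ.suc m) = K.trans (+-homo 1# (m F.· 1#)) (K.+-cong 1#-homo (embed-· m))

  characteristic : n K.· K.1# K.≈ K.0#
  characteristic = K.trans (K.sym (embed-· n)) (K.trans (⟦⟧-cong n·1≈0) 0#-homo)

module TripleOrders
  {c ℓ : Level} {p k : ℕ} (p-prime : Prime p) (p-odd : ¬ 2 ∣ p) (3≤k : 3 ℕ.≤ k)
  (K : Field c ℓ) (p·1≈0 : Field._≈_ K (Field._·_ K p (Field.1# K)) (Field.0# K))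
  (ξ : Field.Carrier K) (ξ-root : Field.IsPrimitiveRoot K (2 ℕ.* k) ξ)
  (α : Field.Carrier K)
  (α²≈-1 : Field._≈_ K (Field._*_ K α α) (Field.-_ K (Field.1# K)))
  where

  open Field K
  open FieldProperties K
  open Projective K hiding (PGL₂; PSL₂)
  open IntegerSolver commutativeRing
  open Triple K ξ α
  open Algebra.Properties.Semiring.Mult semiring using (×-assocˡ; ×-congʳ)
  open Algebra.Properties.Semiring.Exp semiring using (^-homo-*)
  open Algebra.Properties.CommutativeSemiring.Exp commutativeSemiring using (^-distrib-*)
  open SetoidReasoning setoid
  private
    module G = Group (PGL₂ K)
    ζ = ξ ⁻¹
    δ = ξ - ζ

  ·0≈0 : ∀ m → m · 0# ≈ 0#
  ·0≈0 zero      = refl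
  ·0≈0 (ℕ.suc m) = trans (+-identityˡ _) (·0≈0 m)

  ·-multiple : ∀ y {m} → m · 1# ≈ 0# → (y ℕ.* m) · 1# ≈ 0#
  ·-multiple y {m} e = trans (sym (×-assocˡ 1# y m)) (trans (×-congʳ y e) (·0≈0 y))

  m·1≉0 : ∀ m → 0 ℕ.< m → m ℕ.< p → ¬ m · 1# ≈ 0#
  m·1≉0 m 0<m m<p m·1≈0
    with Coprimality.coprime-Bézout (Coprimality.prime⇒coprime p-prime {{ℕ.>-nonZero 0<m}} m<p)
  ... | Bézout.+- x y eq = #⇒≉ 1#0 (begin
    1#                         ≈⟨ sym (+-identityʳ 1#) ⟩
    1# + 0#                    ≈⟨ +-congˡ (sym (·-multiple y m·1≈0)) ⟩
    (1 ℕ.+ y ℕ.* m) · 1#       ≡⟨ ≡.cong (_· 1#) eq ⟩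
    (x ℕ.* p) · 1#             ≈⟨ ·-multiple x p·1≈0 ⟩
    0#                         ∎)
  ... | Bézout.-+ x y eq = #⇒≉ 1#0 (begin
    1#                         ≈⟨ sym (+-identityʳ 1#) ⟩
    1# + 0#                    ≈⟨ +-congˡ (sym (·-multiple x p·1≈0)) ⟩
    (1 ℕ.+ x ℕ.* p) · 1#       ≡⟨ ≡.cong (_· 1#) eq ⟩
    (y ℕ.* m) · 1#             ≈⟨ ·-multiple y m·1≈0 ⟩
    0#                         ∎)

  2<p : 2 ℕ.< p
  2<p = ℕₚ.≤∧≢⇒< (ℕ.nonTrivial⇒n>1 p {{prime⇒nonTrivial p-prime}})
                 (λ 2≡p → p-odd (≡.subst (2 ∣_) 2≡p ∣-refl))

  2#0 : 2 · 1# # 0#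
  2#0 = ≉⇒# (m·1≉0 2 (s≤s z≤n) 2<p)

  2·#0 : ∀ {x} → x # 0# → 2 · x # 0#
  2·#0 {x} x#0 = #-congʳ
    (trans (*-comm _ _) (trans
      (solve 2 (λ x o → x :* (o :+ (o :+ con ℤ.0ℤ)) := x :* o :+ (x :* o :+ con ℤ.0ℤ)) refl x 1#)
      (+-cong (*-identityʳ x) (+-congʳ (*-identityʳ x)))))
    (x#0y#0→xy#0 2#0 x#0)

  -#0 : ∀ {x} → x # 0# → - x # 0#
  -#0 {x} x#0 = ≉⇒# (λ -x≈0 → #⇒≉ x#0 (begin
    x         ≈⟨ solve 1 (λ x → x := :- (:- x)) refl x ⟩
    - (- x)   ≈⟨ -‿cong -x≈0 ⟩
    - 0#      ≈⟨ solve 0 (:- con ℤ.0ℤ := con ℤ.0ℤ) refl ⟩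
    0#        ∎))

  α#0 : α # 0#
  α#0 = unit⇒#0 (- α) (begin
    - α * α      ≈⟨ solve 1 (λ x → (:- x) :* x := :- (x :* x)) refl α ⟩
    - (α * α)    ≈⟨ -‿cong α²≈-1 ⟩
    - (- 1#)     ≈⟨ solve 1 (λ x → :- (:- x) := x) refl 1# ⟩
    1#           ∎)

  private
    2k≥6 : 6 ℕ.≤ 2 ℕ.* k
    2k≥6 = ℕₚ.*-monoʳ-≤ 2 3≤k

  ξ^≉1 : ∀ m → 0 ℕ.< m → m ℕ.< 2 ℕ.* k → ¬ ξ ^ m ≈ 1#
  ξ^≉1 = proj₂ (proj₂ ξ-root)

  ξ^2k≈1 : ξ ^ (2 ℕ.* k) ≈ 1#
  ξ^2k≈1 = proj₁ (proj₂ ξ-root)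

  ξ#0 : ξ # 0#
  ξ#0 = helper (2 ℕ.* k) (ℕₚ.<-≤-trans (s≤s z≤n) 2k≥6) ξ^2k≈1
    where
    helper : ∀ m → 0 ℕ.< m → ξ ^ m ≈ 1# → ξ # 0#
    helper (ℕ.suc m) _ e = unit⇒#0 (ξ ^ m) (trans (*-comm _ _) e)

  ζ#0 : ζ # 0#
  ζ#0 = ⁻¹#0 ξ#0

  ξζ≈1 : ξ * ζ ≈ 1#
  ξζ≈1 = ⁻¹-inverse ξ#0

  δ#0 : δ # 0#
  δ#0 = ≉⇒# (λ δ≈0 → ξ^≉1 2 (s≤s z≤n) (ℕₚ.≤-trans (ℕₚ.m≤m+n 3 3) 2k≥6) (begin
    ξ * (ξ * 1#)      ≈⟨ solve 2 (λ x z → x :* (x :* con ℤ.1ℤ) := x :* (x :- z) :+ x :* z) refl ξ ζ ⟩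
    ξ * δ + ξ * ζ     ≈⟨ +-cong (trans (*-congˡ δ≈0) (zeroʳ ξ)) ξζ≈1 ⟩
    0# + 1#           ≈⟨ +-identityˡ 1# ⟩
    1#                ∎))

  ω#0 : ω # 0#
  ω#0 = ≉⇒# (λ ω≈0 → ξ^≉1 4 (s≤s z≤n) (ℕₚ.≤-trans (ℕₚ.m≤m+n 5 1) 2k≥6) (begin
    ξ * (ξ * (ξ * (ξ * 1#)))
      ≈⟨ solve 2 (λ x z → x :* (x :* (x :* (x :* con ℤ.1ℤ)))
           := (x :* (x :+ z) :- x :* z) :* (x :* (x :+ z) :- x :* z)) refl ξ ζ ⟩
    (ξ * ω - ξ * ζ) * (ξ * ω - ξ * ζ)
      ≈⟨ *-cong (e ω≈0) (e ω≈0) ⟩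
    (0# - 1#) * (0# - 1#)
      ≈⟨ solve 0 ((con ℤ.0ℤ :- con ℤ.1ℤ) :* (con ℤ.0ℤ :- con ℤ.1ℤ) := con ℤ.1ℤ) refl ⟩
    1#  ∎))
    where
    e : ω ≈ 0# → ξ * ω - ξ * ζ ≈ 0# - 1#
    e ω≈0 = +-cong (trans (*-congˡ ω≈0) (zeroʳ ξ)) (-‿cong ξζ≈1)

  private
    two : ∀ {n} → Polynomial n → Polynomial n
    two x = x :+ (x :+ con ℤ.0ℤ)

  det-•#0 : ∀ {x A} → x # 0# → det A # 0# → det (x • A) # 0#
  det-•#0 {x} {A} x#0 A#0 =
    #-congʳ (sym (det-• x A)) (x#0y#0→xy#0 (x#0y#0→xy#0 x#0 x#0) A#0)

  X₀ Y₀ Z₀ : M₂ Carrier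
  X₀ = mat (- ω) (- (2 · ξ)) (2 · ζ) ω
  Y₀ = mat 0# ξ ζ 0#
  Z₀ = mat 0# 1# 1# 0#

  ηα#0 : η * α # 0#
  ηα#0 = x#0y#0→xy#0 (⁻¹#0 δ#0) α#0

  Xᴳ Yᴳ Zᴳ : GL₂
  Xᴳ = X , det-•#0 {A = X₀} ηα#0 (#-congʳ
    (solve 2 (λ x z → :- ((x :- z) :* (x :- z))
      := (:- (x :+ z)) :* (x :+ z) :- (:- two x) :* two z) refl ξ ζ)
    (-#0 (x#0y#0→xy#0 δ#0 δ#0)))
  Yᴳ = Y , det-•#0 {A = Y₀} (-#0 α#0) (#-congʳ
    (solve 2 (λ x z → :- (x :* z) := con ℤ.0ℤ :* con ℤ.0ℤ :- x :* z) refl ξ ζ)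
    (-#0 (x#0y#0→xy#0 ξ#0 ζ#0)))
  Zᴳ = Z , det-•#0 {A = Z₀} α#0 (#-congʳ
    (solve 0 (:- con ℤ.1ℤ := con ℤ.0ℤ :* con ℤ.0ℤ :- con ℤ.1ℤ :* con ℤ.1ℤ) refl)
    (-#0 1#0))

  traceless-order : (A : GL₂) → let open M₂ (proj₁ A) in
    m₁₁ + m₂₂ ≈ 0# → m₁₂ # 0# → HasOrder G.rawMonoid A 2
  traceless-order (A@(mat a b c d) , A#0) tr≈0 b#0 = s≤s z≤n , square , least
    where
    A²≈-det : A *ₘ A ≈ₘ (- det A) • I
    A²≈-det =
      trans (solve 4 (λ a b c d → a :* a :+ b :* c
        := a :* (a :+ d) :+ :- (a :* d :- b :* c) :* con ℤ.1ℤ) refl a b c d) (drop a) ,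
      trans (solve 4 (λ a b c d → a :* b :+ b :* d
        := b :* (a :+ d) :+ :- (a :* d :- b :* c) :* con ℤ.0ℤ) refl a b c d) (drop b) ,
      trans (solve 4 (λ a b c d → c :* a :+ d :* c
        := c :* (a :+ d) :+ :- (a :* d :- b :* c) :* con ℤ.0ℤ) refl a b c d) (drop c) ,
      trans (solve 4 (λ a b c d → c :* b :+ d :* d
        := d :* (a :+ d) :+ :- (a :* d :- b :* c) :* con ℤ.1ℤ) refl a b c d) (drop d)
      where
      drop : ∀ x {y} → x * (a + d) + y ≈ y
      drop x = trans (+-congʳ (trans (*-congˡ tr≈0) (zeroʳ x))) (+-identityˡ _)
    square : (A *ₘ (A *ₘ I)) ~ I
    square = - det A , -#0 A#0 ,
      ≈ₘ-trans (*ₘ-cong (≈ₘ-refl {A}) (*ₘ-identityʳ A)) A²≈-det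
    least : ∀ m → 0 ℕ.< m → m ℕ.< 2 → ¬ mult G.rawMonoid m (A , A#0) G.≈ G.ε
    least 1 _ _ (x , _ , _ , e , _) = #⇒≉ b#0 (begin
      b                  ≈⟨ solve 2 (λ a b → b := a :* con ℤ.0ℤ :+ b :* con ℤ.1ℤ) refl a b ⟩
      a * 0# + b * 1#    ≈⟨ e ⟩
      x * 0#             ≈⟨ zeroʳ x ⟩
      0#                 ∎)
    least (ℕ.suc (ℕ.suc m)) _ (s≤s (s≤s ()))

  X-order : HasOrder G.rawMonoid Xᴳ 2
  X-order = traceless-order Xᴳ
    (solve 2 (λ s w → s :* (:- w) :+ s :* w := con ℤ.0ℤ) refl (η * α) ω)
    (x#0y#0→xy#0 ηα#0 (-#0 (2·#0 ξ#0)))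

  Y-order : HasOrder G.rawMonoid Yᴳ 2
  Y-order = traceless-order Yᴳ
    (solve 1 (λ s → s :* con ℤ.0ℤ :+ s :* con ℤ.0ℤ := con ℤ.0ℤ) refl (- α))
    (x#0y#0→xy#0 (-#0 α#0) ξ#0)

  Z-order : HasOrder G.rawMonoid Zᴳ 2
  Z-order = traceless-order Zᴳ
    (solve 1 (λ s → s :* con ℤ.0ℤ :+ s :* con ℤ.0ℤ := con ℤ.0ℤ) refl α)
    (x#0y#0→xy#0 α#0 1#0)

  XY-order : HasOrder G.rawMonoid (Xᴳ G.∙ Yᴳ) 2
  XY-order = traceless-order (Xᴳ G.∙ Yᴳ)
    (solve 4 (λ s t x z →
      (s :* (:- (x :+ z)) :* (t :* con ℤ.0ℤ) :+ s :* (:- two x) :* (t :* z)) :+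
      (s :* two z :* (t :* x) :+ s :* (x :+ z) :* (t :* con ℤ.0ℤ)) := con ℤ.0ℤ)
      refl (η * α) (- α) ξ ζ)
    (#-congʳ
      (solve 4 (λ s t x z → (:- (s :* t)) :* ((x :+ z) :* x)
        := s :* (:- (x :+ z)) :* (t :* x) :+ s :* (:- two x) :* (t :* con ℤ.0ℤ))
        refl (η * α) (- α) ξ ζ)
      (x#0y#0→xy#0 (-#0 (x#0y#0→xy#0 ηα#0 (-#0 α#0))) (x#0y#0→xy#0 ω#0 ξ#0)))

  open GroupLemmas (PGL₂ K)

  D : GL₂
  D = mat ξ 0# 0# ζ , #-congʳ
    (solve 2 (λ x z → x :* z := x :* z :- con ℤ.0ℤ :* con ℤ.0ℤ) refl ξ ζ)
    (x#0y#0→xy#0 ξ#0 ζ#0)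

  D^ : ∀ n → proj₁ (mult G.rawMonoid n D) ≈ₘ mat (ξ ^ n) 0# 0# (ζ ^ n)
  D^ zero      = ≈ₘ-refl {I}
  D^ (ℕ.suc n) = ≈ₘ-trans (*ₘ-cong (≈ₘ-refl {proj₁ D}) (D^ n))
    ( solve 2 (λ x u → x :* u :+ con ℤ.0ℤ :* con ℤ.0ℤ := x :* u) refl ξ (ξ ^ n)
    , solve 2 (λ x v → x :* con ℤ.0ℤ :+ con ℤ.0ℤ :* v := con ℤ.0ℤ) refl ξ (ζ ^ n)
    , solve 2 (λ z u → con ℤ.0ℤ :* u :+ z :* con ℤ.0ℤ := con ℤ.0ℤ) refl ζ (ξ ^ n)
    , solve 2 (λ z v → con ℤ.0ℤ :* con ℤ.0ℤ :+ z :* v := z :* v) refl ζ (ζ ^ n) )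

  ξ^ζ^≈1 : ∀ n → ξ ^ n * ζ ^ n ≈ 1#
  ξ^ζ^≈1 n = trans (sym (^-distrib-* ξ ζ n)) (go n)
    where
    go : ∀ n → (ξ * ζ) ^ n ≈ 1#
    go zero      = refl
    go (ℕ.suc n) = trans (*-cong ξζ≈1 (go n)) (*-identityˡ 1#)

  ξ^2n : ∀ n → ξ ^ (2 ℕ.* n) ≈ ξ ^ n * ξ ^ n
  ξ^2n n = trans (reflexive (≡.cong (λ t → ξ ^ (n ℕ.+ t)) (ℕₚ.+-identityʳ n))) (^-homo-* ξ n n)

  D-order : HasOrder G.rawMonoid D k
  D-order = ℕₚ.<-≤-trans (s≤s z≤n) 3≤k , ~-trans (≈ₘ⇒~ (D^ k)) Dᵏ~I , least
    where
    ξᵏ≈ζᵏ : ζ ^ k ≈ ξ ^ k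
    ξᵏ≈ζᵏ = begin
      ζ ^ k                        ≈⟨ sym (*-identityˡ _) ⟩
      1# * ζ ^ k                   ≈⟨ *-congʳ (trans (sym ξ^2k≈1) (ξ^2n k)) ⟩
      ξ ^ k * ξ ^ k * ζ ^ k        ≈⟨ *-assoc _ _ _ ⟩
      ξ ^ k * (ξ ^ k * ζ ^ k)      ≈⟨ *-congˡ (ξ^ζ^≈1 k) ⟩
      ξ ^ k * 1#                   ≈⟨ *-identityʳ _ ⟩
      ξ ^ k                        ∎
    Dᵏ~I : mat (ξ ^ k) 0# 0# (ζ ^ k) ~ I
    Dᵏ~I = ξ ^ k , unit⇒#0 (ζ ^ k) (trans (*-comm _ _) (ξ^ζ^≈1 k)) ,
      sym (*-identityʳ _) , sym (zeroʳ _) , sym (zeroʳ _) ,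
      trans ξᵏ≈ζᵏ (sym (*-identityʳ _))
    least : ∀ m → 0 ℕ.< m → m ℕ.< k → ¬ mult G.rawMonoid m D G.≈ G.ε
    least m 0<m m<k Dᵐ~I = power (~-trans (~-sym (≈ₘ⇒~ (D^ m))) Dᵐ~I)
      where
      power : ¬ mat (ξ ^ m) 0# 0# (ζ ^ m) ~ I
      power (x , _ , e , _ , _ , f) = ξ^≉1 (2 ℕ.* m)
        (ℕₚ.<-≤-trans 0<m (ℕₚ.m≤m+n m _)) (ℕₚ.*-monoʳ-< 2 m<k) (begin
        ξ ^ (2 ℕ.* m)     ≈⟨ ξ^2n m ⟩
        ξ ^ m * ξ ^ m     ≈⟨ *-congˡ (trans e (sym f)) ⟩
        ξ ^ m * ζ ^ m     ≈⟨ ξ^ζ^≈1 m ⟩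
        1#                ∎)

  YZ-order : HasOrder G.rawMonoid (Yᴳ G.∙ Zᴳ) k
  YZ-order = HasOrder-≈ {Yᴳ G.∙ Zᴳ} {D} (- α * α , x#0y#0→xy#0 (-#0 α#0) α#0 ,
    ( solve 3 (λ s t x → s :* con ℤ.0ℤ :* (t :* con ℤ.0ℤ) :+ s :* x :* (t :* con ℤ.1ℤ)
        := s :* t :* x) refl (- α) α ξ
    , solve 3 (λ s t x → s :* con ℤ.0ℤ :* (t :* con ℤ.1ℤ) :+ s :* x :* (t :* con ℤ.0ℤ)
        := s :* t :* con ℤ.0ℤ) refl (- α) α ξ
    , solve 3 (λ s t z → s :* z :* (t :* con ℤ.0ℤ) :+ s :* con ℤ.0ℤ :* (t :* con ℤ.1ℤ)
        := s :* t :* con ℤ.0ℤ) refl (- α) α ζ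
    , solve 3 (λ s t z → s :* z :* (t :* con ℤ.1ℤ) :+ s :* con ℤ.0ℤ :* (t :* con ℤ.0ℤ)
        := s :* t :* z) refl (- α) α ζ )) D-order

  -- Z X is a scalar times U (ω / (ζ - ξ)), and U is additive.
  U : Carrier → GL₂
  U w = mat (1# + w) w (- w) (1# - w) , #-congʳ
    (solve 1 (λ w → con ℤ.1ℤ
      := (con ℤ.1ℤ :+ w) :* (con ℤ.1ℤ :- w) :- w :* (:- w)) refl w) 1#0

  U^ : ∀ n w → proj₁ (mult G.rawMonoid n (U w)) ≈ₘ proj₁ (U (n · w))
  U^ zero w =
    solve 0 (con ℤ.1ℤ := con ℤ.1ℤ :+ con ℤ.0ℤ) refl , refl ,
    solve 0 (con ℤ.0ℤ := :- con ℤ.0ℤ) refl ,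
    solve 0 (con ℤ.1ℤ := con ℤ.1ℤ :- con ℤ.0ℤ) refl
  U^ (ℕ.suc n) w = ≈ₘ-trans (*ₘ-cong (≈ₘ-refl {proj₁ (U w)}) (U^ n w))
    ( solve 2 (λ w v → (con ℤ.1ℤ :+ w) :* (con ℤ.1ℤ :+ v) :+ w :* (:- v)
        := con ℤ.1ℤ :+ (w :+ v)) refl w (n · w)
    , solve 2 (λ w v → (con ℤ.1ℤ :+ w) :* v :+ w :* (con ℤ.1ℤ :- v)
        := w :+ v) refl w (n · w)
    , solve 2 (λ w v → (:- w) :* (con ℤ.1ℤ :+ v) :+ (con ℤ.1ℤ :- w) :* (:- v)
        := :- (w :+ v)) refl w (n · w)
    , solve 2 (λ w v → (:- w) :* v :+ (con ℤ.1ℤ :- w) :* (con ℤ.1ℤ :- v)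
        := con ℤ.1ℤ :- (w :+ v)) refl w (n · w) )

  ·-as-* : ∀ n w → n · w ≈ w * (n · 1#)
  ·-as-* zero      w = sym (zeroʳ w)
  ·-as-* (ℕ.suc n) w = trans (+-cong (sym (*-identityʳ w)) (·-as-* n w)) (sym (distribˡ w 1# _))

  U-order : ∀ {w} → w # 0# → HasOrder G.rawMonoid (U w) p
  U-order {w} w#0 = ℕ.>-nonZero⁻¹ p {{prime⇒nonZero p-prime}} ,
    ~-trans (≈ₘ⇒~ (U^ p w)) (≈ₘ⇒~ (≈ₘ-trans (U-cong p·w≈0) (≈ₘ-sym (U^ 0 w)))) , least
    where
    p·w≈0 : p · w ≈ 0#
    p·w≈0 = trans (·-as-* p w) (trans (*-congˡ p·1≈0) (zeroʳ w))
    U-cong : ∀ {v v′} → v ≈ v′ → proj₁ (U v) ≈ₘ proj₁ (U v′)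
    U-cong e = +-congˡ e , e , -‿cong e , +-congˡ (-‿cong e)
    least : ∀ m → 0 ℕ.< m → m ℕ.< p → ¬ mult G.rawMonoid m (U w) G.≈ G.ε
    least m 0<m m<p Uᵐ~I = power (~-trans (~-sym (≈ₘ⇒~ (U^ m w))) Uᵐ~I)
      where
      power : ¬ proj₁ (U (m · w)) ~ I
      power (x , _ , _ , e , _) = m·1≉0 m 0<m m<p
        (*-cancel-0 w#0 (trans (sym (·-as-* m w)) (trans e (zeroʳ x))))

  ZX-order : HasOrder G.rawMonoid (Zᴳ G.∙ Xᴳ) p
  ZX-order = HasOrder-≈ {Zᴳ G.∙ Xᴳ} {U w}
    (α * (η * α) * t , x#0y#0→xy#0 (x#0y#0→xy#0 α#0 ηα#0) t#0 ,
      ( trans (solve 4 (λ r s x z → r :* con ℤ.0ℤ :* (s :* (:- (x :+ z))) :+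
                 r :* con ℤ.1ℤ :* (s :* two z)
                 := r :* s :* ((z :- x) :* con ℤ.1ℤ :+ (x :+ z))) refl α (η * α) ξ ζ)
              (pull _ (trans (+-congˡ (sym tw≈ω)) (sym (distribˡ t 1# w))))
      , trans (solve 4 (λ r s x z → r :* con ℤ.0ℤ :* (s :* (:- two x)) :+
                 r :* con ℤ.1ℤ :* (s :* (x :+ z))
                 := r :* s :* (x :+ z)) refl α (η * α) ξ ζ)
              (pull _ (sym tw≈ω))
      , trans (solve 4 (λ r s x z → r :* con ℤ.1ℤ :* (s :* (:- (x :+ z))) :+
                 r :* con ℤ.0ℤ :* (s :* two z)
                 := r :* s :* (:- (x :+ z))) refl α (η * α) ξ ζ)
              (pull _ (trans (-‿cong (sym tw≈ω))
                (solve 2 (λ t w → :- (t :* w) := t :* (:- w)) refl t w)))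
      , trans (solve 4 (λ r s x z → r :* con ℤ.1ℤ :* (s :* (:- two x)) :+
                 r :* con ℤ.0ℤ :* (s :* (x :+ z))
                 := r :* s :* ((z :- x) :* con ℤ.1ℤ :- (x :+ z))) refl α (η * α) ξ ζ)
              (pull _ (trans (+-congˡ (-‿cong (sym tw≈ω)))
                (solve 2 (λ t w → t :* con ℤ.1ℤ :- t :* w := t :* (con ℤ.1ℤ :- w)) refl t w)))
      )) (U-order w#0)
    where
    t = ζ - ξ
    w = ω * t ⁻¹
    t#0 : t # 0#
    t#0 = #-congʳ (solve 2 (λ x z → :- (x :- z) := z :- x) refl ξ ζ) (-#0 δ#0)
    w#0 : w # 0#
    w#0 = x#0y#0→xy#0 ω#0 (⁻¹#0 t#0)
    tw≈ω : t * w ≈ ω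
    tw≈ω = trans (solve 3 (λ t o u → t :* (o :* u) := o :* (t :* u)) refl t ω (t ⁻¹))
                 (trans (*-congˡ (⁻¹-inverse t#0)) (*-identityʳ ω))
    pull : ∀ s {x y} → x ≈ t * y → s * x ≈ s * t * y
    pull s e = trans (*-congˡ e) (sym (*-assoc s t _))

  tripleMap : RegularMap k p (c ⊔ ℓ) (c ⊔ ℓ)
  tripleMap = generatedMap Xᴳ Yᴳ Zᴳ X-order Y-order Z-order XY-order YZ-order ZX-order

-- The regular map of type (k , p) whose group is the subgroup of PGL₂ K
-- generated by Triple.X, Triple.Y and Triple.Z.
regularMap : ∀ {p k} → Prime p → ¬ 2 ∣ p → 3 ℕ.≤ k → (K̄ : AlgebraicClosureGF p c ℓ) →
  let open AlgebraicClosureGF K̄; open Field K in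
  (ξ : Carrier) → IsPrimitiveRoot (2 ℕ.* k) ξ → (α : Carrier) → α * α ≈ - 1# →
  RegularMap k p (c ⊔ ℓ) (c ⊔ ℓ)
regularMap p-prime p-odd 3≤k K̄ ξ ξ-root α α²≈-1 =
  TripleOrders.tripleMap p-prime p-odd 3≤k K (FiniteFieldLemmas.characteristic GF)
    ξ ξ-root α α²≈-1
  where open AlgebraicClosureGF K̄

{-# OPTIONS --safe #-}
-- Write n = k/2. As ξ is a primitive 2k-th root of unity, ξᵏ = -1, so ξⁿ and
-- ξ⁻ⁿ are opposite and Rⁿ is projectively J = diag(1, -1). Up to scalars,
-- X J X has diagonal entries ±(ω² + 4) and off-diagonal entries 4ω times those
-- of J Y, whose diagonal vanishes; and 4ω ≠ 0.
module Submission where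

open import Defs
open import Data.Nat using (ℕ; NonZero; _≤_) renaming (_*_ to _*ℕ_; _^_ to _^ℕ_)
open import Data.Nat.Coprimality using (Coprime)
open import Data.Nat.Divisibility using (_∣_)
open import Data.Nat.Primality using (Prime)
open import Data.Sum using (_⊎_)
open import Function.Bundles using (_⇔_)
open import Relation.Nullary using (¬_)
open import Algebra.Bundles using (Group)
open import Algebra.Definitions.RawMonoid using () renaming (_×_ to mult)
import Algebra.Properties.Monoid.Mult
open import Data.Integer.Base using (0ℤ; 1ℤ)
import Data.Nat.Base as ℕ
open import Data.Nat.Divisibility using (divides)
open import Data.Nat.DivMod using (_/_; m*n/n≡m)
import Data.Nat.Properties as ℕₚ
open import Data.Product using (_,_; proj₁; proj₂)
open import Function.Bundles using (mk⇔)
open import Function.Construct.Composition using (_⇔-∘_)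
open import Relation.Binary.PropositionalEquality using (_≡_; cong) renaming (sym to ≡-sym; trans to ≡-trans)
import Relation.Binary.Reasoning.Setoid as SetoidReasoning

2*[n/2]≡n : ∀ {n} → 2 ∣ n → 2 *ℕ (n / 2) ≡ n
2*[n/2]≡n (divides q n≡q*2) = ≡-trans
  (cong (2 *ℕ_) (≡-trans (cong (_/ 2) n≡q*2) (m*n/n≡m q 2)))
  (≡-trans (ℕₚ.*-comm 2 q) (≡-sym n≡q*2))

module _ {a b} (G : Group a b) where
  open Group G
  open GroupLemmas G
  open Algebra.Properties.Monoid.Mult monoid using (×-congʳ)

  -- Equality and multiplication in the generated subgroup are those of `G` on first components, so
  -- the criterion can be tested in `G`. There `R` may be replaced by any equal `D` whose powers are
  -- easy to compute, even one not given as a word in the generators.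
  generatedMap-möbiusRegular⇔ : ∀ X Y Z {k l}
    (oX : HasOrder rawMonoid X 2) (oY : HasOrder rawMonoid Y 2) (oZ : HasOrder rawMonoid Z 2)
    (oXY : HasOrder rawMonoid (X ∙ Y) 2) (oYZ : HasOrder rawMonoid (Y ∙ Z) k)
    (oZX : HasOrder rawMonoid (Z ∙ X) l) → 2 ∣ k →
    ∀ {D J} → Y ∙ Z ≈ D → mult rawMonoid (k / 2) D ≈ J →
    MöbiusRegular (generatedMap X Y Z oX oY oZ oXY oYZ oZX) ⇔ (X ∙ J ∙ X ≈ J ∙ Y)
  generatedMap-möbiusRegular⇔ X Y Z {k} oX oY oZ oXY oYZ oZX 2∣k {D} {J} YZ≈D Dⁿ≈J = mk⇔
    (λ (_ , eq) → trans (sym XRX≈XJX) (trans eq (∙-congʳ R≈J)))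
    (λ eq → 2∣k , trans XRX≈XJX (trans eq (sym (∙-congʳ R≈J))))
    where
    module M = RegularMap (generatedMap X Y Z oX oY oZ oXY oYZ oZX)
    Rⁿ = proj₁ (mult (Group.rawMonoid M.group) (k / 2) M.R)
    R≈J : Rⁿ ≈ J
    R≈J = trans (reflexive (mult-proj₁ X Y Z (k / 2) M.R)) (trans (×-congʳ (k / 2) YZ≈D) Dⁿ≈J)
    XRX≈XJX : X ∙ Rⁿ ∙ X ≈ X ∙ J ∙ X
    XRX≈XJX = ∙-congʳ (∙-congˡ R≈J)

module _
  {c ℓ} {p k : ℕ} (p-prime : Prime p) (p-odd : ¬ 2 ∣ p) (3≤k : 3 ≤ k)
  (K : Field c ℓ) (p·1≈0 : Field._≈_ K (Field._·_ K p (Field.1# K)) (Field.0# K))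
  (ξ : Field.Carrier K) (ξ-root : Field.IsPrimitiveRoot K (2 *ℕ k) ξ)
  (α : Field.Carrier K)
  (α²≈-1 : Field._≈_ K (Field._*_ K α α) (Field.-_ K (Field.1# K)))
  where

  open Field K
  open FieldProperties K
  open Projective K hiding (PGL₂; PSL₂)
  open IntegerSolver commutativeRing
  open Triple K ξ α
  open TripleOrders p-prime p-odd 3≤k K p·1≈0 ξ ξ-root α α²≈-1
  open Algebra.Properties.Monoid.Mult +-monoid using (×-congʳ)
  open SetoidReasoning setoid
  private
    module G = Group (PGL₂ K)

  -- The square of `ξ ^ k` is 1, so `(x - 1#) * (x + 1#)` vanishes at `x = ξ ^ k`. The first factor
  -- is invertible because `ξ` has order 2k > k, so the second one is zero.
  ξ^k≈-1 : ξ ^ k ≈ - 1#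
  ξ^k≈-1 = begin
    x                ≈⟨ solve 1 (λ x → x := (x :+ con 1ℤ) :- con 1ℤ) refl x ⟩
    (x + 1#) - 1#    ≈⟨ +-congʳ (*-cancel-0 x-1#0 x²-1≈0) ⟩
    0# - 1#          ≈⟨ +-identityˡ _ ⟩
    - 1#             ∎
    where
    x = ξ ^ k
    0<k : 0 ℕ.< k
    0<k = ℕₚ.<-≤-trans (ℕ.s≤s ℕ.z≤n) 3≤k
    x-1#0 : x - 1# # 0#
    -- `2 *ℕ k` reduces to `k + (k + 0)`, hence the bound needs `k + 0` to be positive.
    x-1#0 = ≉⇒# (λ x-1≈0 → ξ^≉1 k 0<k (ℕₚ.m<m+n k (ℕₚ.<-≤-trans 0<k (ℕₚ.m≤m+n k 0))) (begin
      x                ≈⟨ solve 1 (λ x → x := (x :- con 1ℤ) :+ con 1ℤ) refl x ⟩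
      (x - 1#) + 1#    ≈⟨ +-congʳ x-1≈0 ⟩
      0# + 1#          ≈⟨ +-identityˡ 1# ⟩
      1#               ∎))
    x²-1≈0 : (x - 1#) * (x + 1#) ≈ 0#
    x²-1≈0 = begin
      (x - 1#) * (x + 1#)
        ≈⟨ solve 1 (λ x → (x :- con 1ℤ) :* (x :+ con 1ℤ) := x :* x :- con 1ℤ) refl x ⟩
      x * x - 1#    ≈⟨ +-congʳ (trans (sym (ξ^2n k)) ξ^2k≈1) ⟩
      1# - 1#       ≈⟨ -‿inverseʳ 1# ⟩
      0#            ∎

  J : GL₂
  J = mat 1# 0# 0# (- 1#) , #-congʳ
    (solve 0 (:- con 1ℤ := con 1ℤ :* (:- con 1ℤ) :- con 0ℤ :* con 0ℤ) refl) (-#0 1#0)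

  -- `D` is diagonal, so its n-th power is diag(u, v) with `u * v ≈ 1#` and `u * u ≈ ξ ^ k ≈ - 1#`.
  -- These give v = -u, and the projective scalar is `u`.
  D^[k/2]≈J : ∀ n → 2 *ℕ n ≡ k → mult G.rawMonoid n D G.≈ J
  D^[k/2]≈J n 2n≡k = ~-trans (≈ₘ⇒~ (D^ n)) (u , u#0 ,
    sym (*-identityʳ u) , sym (zeroʳ u) , sym (zeroʳ u) , v≈-u)
    where
    u = ξ ^ n
    v = ξ ⁻¹ ^ n
    u#0 : u # 0#
    u#0 = unit⇒#0 v (trans (*-comm v u) (ξ^ζ^≈1 n))
    v≈-u : v ≈ u * - 1#
    v≈-u = begin
      -- A factor -1 is exposed so that it can be rewritten as `ξ ^ k`, that is `u * u`; one `u`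
      -- then cancels against `v`.
      v                 ≈⟨ solve 1 (λ v → v := :- (:- con 1ℤ :* v)) refl v ⟩
      - (- 1# * v)      ≈⟨ -‿cong (*-congʳ (sym ξ^k≈-1)) ⟩
      - (ξ ^ k * v)     ≡⟨ cong (λ m → - (ξ ^ m * v)) (≡-sym 2n≡k) ⟩
      - (ξ ^ (2 *ℕ n) * v) ≈⟨ -‿cong (*-congʳ (ξ^2n n)) ⟩
      - (u * u * v)     ≈⟨ solve 2 (λ u v → :- (u :* u :* v) := u :* (:- (u :* v))) refl u v ⟩
      u * - (u * v)     ≈⟨ *-congˡ (-‿cong (ξ^ζ^≈1 n)) ⟩
      u * - 1#          ∎

  YZ≈D : Yᴳ G.∙ Zᴳ G.≈ D
  YZ≈D = ~-trans (*ₘ-~-cong {B′ = Z₀} (- α , -#0 α#0 , ≈ₘ-refl {Y}) (α , α#0 , ≈ₘ-refl {Z}))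
    (≈ₘ⇒~
      ( solve 1 (λ x → con 0ℤ :* con 0ℤ :+ x :* con 1ℤ := x) refl ξ
      , solve 1 (λ x → con 0ℤ :* con 1ℤ :+ x :* con 0ℤ := con 0ℤ) refl ξ
      , solve 1 (λ z → z :* con 0ℤ :+ con 0ℤ :* con 1ℤ := con 0ℤ) refl (ξ ⁻¹)
      , solve 1 (λ z → z :* con 1ℤ :+ con 0ℤ :* con 0ℤ := z) refl (ξ ⁻¹) ))

  -- The off-diagonal entries are polynomial identities with `ω` as an independent variable. The
  -- diagonal ones come out as ±(ω² + 4ξξ⁻¹), and `ξζ≈1` turns the last term into 4.
  X₀JX₀ : X₀ *ₘ proj₁ J *ₘ X₀ ≈ₘ
    mat (ω * ω + 4 · 1#)          (2 · (2 · ω) * ξ)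
        (2 · (2 · ω) * - (ξ ⁻¹))  (- (ω * ω + 4 · 1#))
  X₀JX₀ =
    trans (solve 3 (λ w x z →
      (:- w :* con 1ℤ :+ :- two x :* con 0ℤ) :* (:- w) :+
      (:- w :* con 0ℤ :+ :- two x :* :- con 1ℤ) :* two z
      := w :* w :+ two (two (x :* z))) refl ω ξ (ξ ⁻¹))
      (+-congˡ four) ,
    solve 2 (λ w x →
      (:- w :* con 1ℤ :+ :- two x :* con 0ℤ) :* (:- two x) :+
      (:- w :* con 0ℤ :+ :- two x :* :- con 1ℤ) :* w
      := two (two w) :* x) refl ω ξ ,
    solve 2 (λ w z →
      (two z :* con 1ℤ :+ w :* con 0ℤ) :* (:- w) :+
      (two z :* con 0ℤ :+ w :* :- con 1ℤ) :* two z
      := two (two w) :* :- z) refl ω (ξ ⁻¹) ,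
    trans (solve 3 (λ w x z →
      (two z :* con 1ℤ :+ w :* con 0ℤ) :* (:- two x) :+
      (two z :* con 0ℤ :+ w :* :- con 1ℤ) :* w
      := :- (w :* w :+ two (two (x :* z)))) refl ω ξ (ξ ⁻¹))
      (-‿cong (+-congˡ four))
    where
    two : ∀ {n} → Polynomial n → Polynomial n
    two x = x :+ (x :+ con 0ℤ)
    -- Nested doubling, as produced by the factors 2 in `X₀`, has to be matched with the fourfold
    -- sum in the criterion.
    four : 2 · (2 · (ξ * ξ ⁻¹)) ≈ 4 · 1#
    four = trans
      (solve 1 (λ y → two (two y) := y :+ (y :+ (y :+ (y :+ con 0ℤ)))) refl (ξ * ξ ⁻¹))
      (×-congʳ 4 ξζ≈1)

  JY₀ : proj₁ J *ₘ Y₀ ≈ₘ mat 0# ξ (- (ξ ⁻¹)) 0#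
  JY₀ =
    solve 1 (λ z → con 1ℤ :* con 0ℤ :+ con 0ℤ :* z := con 0ℤ) refl (ξ ⁻¹) ,
    solve 1 (λ x → con 1ℤ :* x :+ con 0ℤ :* con 0ℤ := x) refl ξ ,
    solve 1 (λ z → con 0ℤ :* con 0ℤ :+ :- con 1ℤ :* z := :- z) refl (ξ ⁻¹) ,
    solve 1 (λ x → con 0ℤ :* x :+ :- con 1ℤ :* con 0ℤ := con 0ℤ) refl ξ

  XJX≈JY⇔ : (Xᴳ G.∙ J G.∙ Xᴳ G.≈ J G.∙ Yᴳ) ⇔ (ω * ω + 4 · 1# ≈ 0#)
  XJX≈JY⇔ = mk⇔
    (λ XJX~JY → diagonal (~-trans (~-sym XJX~) (~-trans XJX~JY JY~)))
    (λ e → ~-trans XJX~ (~-trans (scalar e) (~-sym JY~)))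
    where
    P Q : M₂ Carrier
    P = mat (ω * ω + 4 · 1#) (2 · (2 · ω) * ξ) (2 · (2 · ω) * - (ξ ⁻¹)) (- (ω * ω + 4 · 1#))
    Q = mat 0# ξ (- (ξ ⁻¹)) 0#
    X~X₀ : X ~ X₀
    X~X₀ = η * α , ηα#0 , ≈ₘ-refl {X}
    XJX~ : X *ₘ proj₁ J *ₘ X ~ P
    XJX~ = ~-trans
      (*ₘ-~-cong (*ₘ-~-cong X~X₀ (≈ₘ⇒~ (≈ₘ-refl {proj₁ J}))) X~X₀)
      (≈ₘ⇒~ X₀JX₀)
    JY~ : proj₁ J *ₘ Y ~ Q
    JY~ = ~-trans
      (*ₘ-~-cong (≈ₘ⇒~ (≈ₘ-refl {proj₁ J})) (- α , -#0 α#0 , ≈ₘ-refl {Y}))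
      (≈ₘ⇒~ JY₀)
    diagonal : P ~ Q → ω * ω + 4 · 1# ≈ 0#
    -- The top-left entry of `Q` is zero, so every scalar multiple of `Q` has a zero there.
    diagonal (x , _ , e , _) = trans e (zeroʳ x)
    scalar : ω * ω + 4 · 1# ≈ 0# → P ~ Q
    -- The scalar is 4ω, read off the off-diagonal entries. It is nonzero: p is odd, and ω = 0 would
    -- give ξ⁴ = 1, against the order 2k ≥ 6.
    scalar e = 2 · (2 · ω) , 2·#0 (2·#0 ω#0) ,
      trans e (sym (zeroʳ _)) , refl , refl ,
      trans (-‿cong e) (solve 1 (λ s → :- con 0ℤ := s :* con 0ℤ) refl (2 · (2 · ω)))

  tripleMap-möbiusRegular⇔ : 2 ∣ k → MöbiusRegular tripleMap ⇔ (ω * ω + 4 · 1# ≈ 0#)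
  tripleMap-möbiusRegular⇔ 2∣k = XJX≈JY⇔ ⇔-∘
    generatedMap-möbiusRegular⇔ (PGL₂ K) Xᴳ Yᴳ Zᴳ X-order Y-order Z-order XY-order YZ-order ZX-order
      2∣k {D} {J} YZ≈D (D^[k/2]≈J (k / 2) (2*[n/2]≡n 2∣k))

proposition3p7 :
  ∀ {c ℓ} (p e k : ℕ) .{{_ : NonZero p}} .{{_ : NonZero k}} →
  (p-prime : Prime p) (p-odd : ¬ (2 ∣ p)) → 1 ≤ e →
  (3≤k : 3 ≤ k) → 2 ∣ k → Coprime k p → Hyperbolic k p →
  (K̄ : AlgebraicClosureGF p c ℓ) →
  let open AlgebraicClosureGF K̄
      open Field K in
  (GFq : FiniteSubfield K (p ^ℕ e)) (GFq² : FiniteSubfield K ((p ^ℕ e) ^ℕ 2)) →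
  (ξ : Carrier) (ξ-root : IsPrimitiveRoot (2 *ℕ k) ξ) → (ξ ∈ₛ GFq) ⊎ (ξ ∈ₛ GFq²) →
  (α : Carrier) (α²≈-1 : α * α ≈ - 1#) →
  let ω = Triple.ω K ξ α
      M = regularMap p-prime p-odd 3≤k K̄ ξ ξ-root α α²≈-1
      G = RegularMap.group M
      F = FiniteSubfield.subfield GFq in
  (G ≅ PSL₂ F) ⊎ (G ≅ PGL₂ F) →
  MöbiusRegular M ⇔ (ω * ω + 4 · 1# ≈ 0#)
proposition3p7 p e k p-prime p-odd _ 3≤k 2∣k _ _ K̄ _ _ ξ ξ-root _ α α²≈-1 _ =
  -- `regularMap` unfolds to `tripleMap` over `K`. The relation p · 1 = 0 is inherited from the
  -- embedded field `GF` with p elements.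
  tripleMap-möbiusRegular⇔ p-prime p-odd 3≤k K
    (FiniteFieldLemmas.characteristic GF) ξ ξ-root α α²≈-1 2∣k
  where open AlgebraicClosureGF K̄
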